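{- Let $\mu$ be an infinite cardinal and let $G$ be a graph with $\operatorname{col}(G)>\mu$. Then $G$ contains either a $K_\mu$ or, for each positive integer $k$, an induced $K_{k,\omega}$.
   Context: Graphs are simple and undirected, possibly infinite; $N(v)$ denotes the set of neighbours of a vertex $v$. The colouring number $\operatorname{col}(G)$ of a graph $G=(V,E)$ is the smallest cardinal $\kappa$ such that there exists a well-ordering $<^*$ of $V$ with $|N(v)\cap\{w : w<^* v\}|<\kappa$ for all $v\in V$. Here $K_\mu$ denotes the complete graph on $\mu$ vertices, i.e. containing a $K_\mu$ means containing $\mu$ mutually adjacent vertices, and $K_{k,\omega}$ denotes the complete bipartite graph whose classes have sizes $k$ and $\omega$ (countably infinite). -}

module Defs where

open import Data.Fin using (Fin)
open import Data.Product using (Σ; Σ-syntax; ∃; _×_; proj₁)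
open import Data.Sum using (_⊎_; inj₁; inj₂)
open import Function.Bundles using (Injection; _⤖_)
open import Function.Definitions using (Injective)
open import Induction.WellFounded using (WellFounded)
open import Level using (Level; suc; _⊔_)
open import Relation.Binary.Bundles using (Setoid)
open import Relation.Binary.Core using (Rel)
open import Relation.Binary.Definitions using (Irreflexive; Symmetric)
open import Relation.Binary.PropositionalEquality using (_≡_; _≢_; refl; ≢-sym; setoid)
open import Relation.Binary.Structures using (IsStrictTotalOrder)
open import Relation.Nullary using (¬_)
open import Relation.Unary using (Pred; Satisfiable; _≐_; _∩_)
import Relation.Binary.Construct.On as On

private
  variable
    a b p v v′ e e′ ℓ : Level

-- Zermelo's axiom of choice: every A has a choice function on its nonempty
-- subsets.  The last clause makes the chosen element depend only on the
-- extension of the subset, neither on the predicate presenting it nor on the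
-- witness of nonemptiness.  Without it the statement would be provable
-- outright, since Satisfiable P already supplies an element.
AxiomOfChoice : ∀ ℓ → Set (suc ℓ)
AxiomOfChoice ℓ =
  (A : Set ℓ) →
  Σ[ choose ∈ ((P : Pred A ℓ) → Satisfiable P → A) ]
    ((∀ P (s : Satisfiable P) → P (choose P s)) ×
     (∀ P Q (s : Satisfiable P) (t : Satisfiable Q) → P ≐ Q → choose P s ≡ choose Q t))

-- Cardinals are represented by types, and compared by means of injections.
-- A subset counts as the setoid of its members, with equality that of the
-- ambient type, so that different proofs of membership are not counted
-- separately.

infix 4 _≼_ _≺_

_≼_ : Setoid a ℓ → Setoid b p → Set (a ⊔ ℓ ⊔ b ⊔ p)
S ≼ T = Injection S T

_≺_ : Setoid a ℓ → Setoid b p → Set (a ⊔ ℓ ⊔ b ⊔ p)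
S ≺ T = S ≼ T × ¬ (T ≼ S)

members : {A : Set a} → Pred A p → Setoid (a ⊔ p) a
members {A = A} P = On.setoid {B = Σ A P} (setoid A) proj₁

Infinite : Set a → Set a
Infinite A = ¬ (∃ λ n → A ⤖ Fin n)

record Graph v e : Set (suc (v ⊔ e)) where
  field
    V      : Set v
    Adj    : Rel V e
    sym    : Symmetric Adj
    irrefl : Irreflexive _≡_ Adj

  N : V → Pred V e
  N x y = Adj x y

IsWellOrder : {A : Set a} → Rel A ℓ → Set (a ⊔ ℓ)
IsWellOrder _<_ = IsStrictTotalOrder _≡_ _<_ × WellFounded _<_

module _ (G : Graph ℓ ℓ) where
  open Graph G

  HasColouringOrder : Set ℓ → Set (suc ℓ)
  HasColouringOrder κ =
    Σ[ _<*_ ∈ Rel V ℓ ]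
      (IsWellOrder _<*_ ×
       (∀ x → members (N x ∩ (λ w → w <* x)) ≺ setoid κ))

  -- "κ = col(G)", as a relation because col(G) is only determined up to
  -- equipotence.
  IsColouringNumber : Set ℓ → Set (suc ℓ)
  IsColouringNumber κ =
    HasColouringOrder κ × (∀ κ′ → HasColouringOrder κ′ → setoid κ ≼ setoid κ′)

complete : Set v → Graph v v
complete A = record
  { V      = A
  ; Adj    = _≢_
  ; sym    = ≢-sym
  ; irrefl = λ x≡y x≢y → x≢y x≡y
  }

data Across {A : Set a} {B : Set b} : Rel (A ⊎ B) (a ⊔ b) where
  left-right : ∀ x y → Across (inj₁ x) (inj₂ y)
  right-left : ∀ x y → Across (inj₂ y) (inj₁ x)

completeBipartite : Set a → Set b → Graph (a ⊔ b) (a ⊔ b)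
completeBipartite A B = record
  { V      = A ⊎ B
  ; Adj    = Across
  ; sym    = λ { (left-right x y) → right-left x y ; (right-left x y) → left-right x y }
  ; irrefl = λ { refl () }
  }

record Contains (G : Graph v e) (H : Graph v′ e′) : Set (v ⊔ e ⊔ v′ ⊔ e′) where
  private
    module G = Graph G
    module H = Graph H
  field
    embed     : H.V → G.V
    injective : Injective _≡_ _≡_ embed
    preserves : ∀ {x y} → H.Adj x y → G.Adj (embed x) (embed y)

record ContainsInduced (G : Graph v e) (H : Graph v′ e′) : Set (v ⊔ e ⊔ v′ ⊔ e′) where
  field
    contains : Contains G H
  open Contains contains public
  field
    reflects : ∀ {x y} → Graph.Adj G (embed x) (embed y) → Graph.Adj H x y

{-# OPTIONS --safe #-}

-- Suppose there is no K_μ and, for some k > 0, no induced K_{k,ω}.  By the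
-- Dushnik–Miller theorem μ → (μ, ω)² every set of at least μ vertices contains
-- an infinite independent set.  Hence an independent k-set has fewer than μ
-- common neighbours; and if A is closed, meaning that it contains the common
-- neighbours of its independent k-subsets, then every vertex outside A has fewer
-- than μ neighbours in A.
--
-- By induction on the cardinality of X, the closure of X has a well-order in
-- which every vertex has fewer than μ earlier neighbours.  If |X| ≤ μ, so is the
-- size of its closure, and an order of type at most μ will do.  Otherwise write X
-- as x_α, α < |X|, and order the vertices by the least α for which they lie in the
-- closure of {x_β : β ≤ α}; the layers so obtained are ordered by induction, and
-- earlier layers contribute few neighbours because their union is closed.
-- Counting generators rather than elements makes cardinal arithmetic for the
-- closures of proper segments unnecessary.  Thus col(G) ≤ μ.
module Submission where

open import Axiom.ExcludedMiddle using (ExcludedMiddle)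
open import Data.Bool using (Bool; true; false; T; if_then_else_)
open import Data.Bool.Properties using (T-irrelevant)
open import Data.Empty using (⊥; ⊥-elim)
open import Data.Fin using (Fin; zero; suc; toℕ; fromℕ<; combine; punchOut)
open import Data.Fin.Properties
  using (toℕ<n; toℕ-injective; fromℕ<-injective; suc-injective; punchOut-injective; combine-injective;
         ℕ→Fin-notInjective)
open import Data.Nat as ℕ using (ℕ; zero; suc; NonZero)
import Data.Nat.Properties as ℕ
open import Data.Maybe as Maybe using (Maybe; just; nothing)
open import Data.Maybe.Properties using (just-injective; map-injective)
open import Data.Product using (Σ; Σ-syntax; ∃; _×_; _,_; proj₁; proj₂)
open import Data.Sum using (_⊎_; inj₁; inj₂; [_,_]′)
open import Data.Sum.Properties using (inj₁-injective; inj₂-injective)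
open import Data.Unit using (⊤; tt)
open import Data.Vec using (Vec; lookup; tabulate)
open import Data.Vec.Properties using (lookup∘tabulate; tabulate∘lookup; tabulate-cong)
open import Function using (_∘_; id)
open import Function.Bundles using (Injection; _↣_; mk↣; _⤖_; mk⤖)
open import Function.Construct.Composition using () renaming (_↣-∘_ to infixr 8 _∘↣_)
open import Function.Construct.Identity using (↣-id)
open import Function.Definitions using (Injective)
open import Induction.WellFounded using (WellFounded; Acc; acc; wf⇒asym)
open import Level using (Level; _⊔_; Lift; lift; lower; 0ℓ) renaming (suc to lsuc)
open import Relation.Binary.Core using (Rel)
open import Relation.Binary.Definitions using (Symmetric; Tri; tri<; tri≈; tri>)
open import Relation.Binary.PropositionalEquality
  using (_≡_; _≢_; refl; sym; trans; cong; cong₂; subst; setoid; isEquivalence)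
open import Relation.Nullary using (¬_; Dec; yes; no)
open import Relation.Nullary.Decidable using (isYes; toWitness; fromWitness; decidable-stable)
open import Relation.Unary using (Pred; Satisfiable; _⊆_; _∩_)
open import Defs

open Injection using (to; injective)

private
  variable
    a b p q r ℓ ℓ′ : Level
    A B C D : Set a

-- Well-orders

record WellOrder (A : Set a) : Set (lsuc 0ℓ ⊔ a) where
  infix 4 _<_
  field
    _<_   : Rel A 0ℓ
    total : ∀ x y → x < y ⊎ x ≡ y ⊎ y < x
    wf    : WellFounded _<_

  asym : ∀ {x y} → x < y → ¬ (y < x)
  asym = wf⇒asym wf

  irrefl : ∀ {x} → ¬ (x < x)
  irrefl x<x = asym x<x x<x

  -- Well-foundedness forbids cycles: a cycle through `x` can be rotated to start at the smaller
  -- `z`. With totality this yields transitivity, which is therefore not a field of `WellOrder`.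
  no-3-cycle : ∀ {x y z} → x < y → y < z → ¬ (z < x)
  no-3-cycle {x} = go (wf x)
    where
    go : ∀ {x y z} → Acc _<_ x → x < y → y < z → ¬ (z < x)
    go (acc rs) x<y y<z z<x = go (rs z<x) z<x x<y y<z

  <-trans : ∀ {x y z} → x < y → y < z → x < z
  <-trans {x} {y} {z} x<y y<z with total x z
  ... | inj₁ x<z         = x<z
  ... | inj₂ (inj₁ refl) = ⊥-elim (asym x<y y<z)
  ... | inj₂ (inj₂ z<x)  = ⊥-elim (no-3-cycle x<y y<z z<x)

  _≤_ : A → A → Set _
  x ≤ y = x < y ⊎ x ≡ y

  <-≤-trans : ∀ {x y z} → x < y → y ≤ z → x < z
  <-≤-trans x<y (inj₁ y<z)  = <-trans x<y y<z
  <-≤-trans x<y (inj₂ refl) = x<y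

  ≤-<-trans : ∀ {x y z} → x ≤ y → y < z → x < z
  ≤-<-trans (inj₁ x<y)  y<z = <-trans x<y y<z
  ≤-<-trans (inj₂ refl) y<z = y<z

  ≤-trans : ∀ {x y z} → x ≤ y → y ≤ z → x ≤ z
  ≤-trans (inj₁ x<y)  y≤z = inj₁ (<-≤-trans x<y y≤z)
  ≤-trans (inj₂ refl) y≤z = y≤z

-- Classical logic, subsets as types, coverings

module Classical (em : ∀ {a} → ExcludedMiddle a) (ac : ∀ {a} → AxiomOfChoice a) where

  dne : {P : Set p} → ¬ ¬ P → P
  dne = decidable-stable em

  ¬∀⇒∃¬ : {P : A → Set p} → ¬ (∀ x → P x) → ∃ λ x → ¬ P x
  ¬∀⇒∃¬ ¬all = dne λ ¬ex → ¬all λ x → dne λ ¬px → ¬ex (x , ¬px)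

  -- Excluded middle resizes every proposition into Set₀ and makes its proofs
  -- unique, so that subsets of a type in Set ℓ are again types in Set ℓ whose
  -- equality is that of the ambient type.
  opaque
    truth : Set p → Bool
    truth P = isYes (em {P = P})

    ∣_∣ : {P : Set p} → P → T (truth P)
    ∣_∣ = fromWitness

    out : {P : Set p} → T (truth P) → P
    out = toWitness

  ∥_∥ : Set p → Set
  ∥ P ∥ = T (truth P)

  ⟦_⟧ : {A : Set a} → (A → Bool) → Set a
  ⟦_⟧ {A = A} S = Σ[ x ∈ A ] T (S x)

  Sub : {A : Set a} → Pred A p → Set a
  Sub P = ⟦ (λ x → truth (P x)) ⟧

  ⟦⟧-≡ : {S : A → Bool} {x y : ⟦ S ⟧} → proj₁ x ≡ proj₁ y → x ≡ y
  ⟦⟧-≡ {x = _ , s} {_ , t} refl = cong (_ ,_) (T-irrelevant s t)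

  inclusion : {S : A → Bool} → ⟦ S ⟧ ↣ A
  inclusion = mk↣ {to = proj₁} ⟦⟧-≡

  Sub-map : {P : Pred A p} {Q : Pred B q} (f : A ↣ B) → (∀ {x} → P x → Q (to f x)) → Sub P ↣ Sub Q
  Sub-map f P⇒Q = mk↣ {to = λ (x , px) → to f x , ∣ P⇒Q (out px) ∣}
    λ eq → ⟦⟧-≡ (injective f (cong proj₁ eq))

  Sub-mono : {P : Pred A p} {Q : Pred A q} → P ⊆ Q → Sub P ↣ Sub Q
  Sub-mono P⊆Q = Sub-map (↣-id _) P⊆Q

  adjoin : {P : Pred A p} {x : A} → Sub (λ y → P y ⊎ y ≡ x) ↣ Maybe (Sub P)
  adjoin {P = P} {x} = mk↣ {to = λ (y , h) → enc (out h)}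
    λ {(y , h)} {(z , h′)} eq → ⟦⟧-≡ (enc-injective (out h) (out h′) eq)
    where
    enc : ∀ {y} → P y ⊎ y ≡ x → Maybe (Sub P)
    enc (inj₁ Py) = just (_ , ∣ Py ∣)
    enc (inj₂ _)  = nothing

    enc-injective : ∀ {y z} (h : P y ⊎ y ≡ x) (h′ : P z ⊎ z ≡ x) → enc h ≡ enc h′ → y ≡ z
    enc-injective (inj₁ _)    (inj₁ _)    eq = cong proj₁ (just-injective eq)
    enc-injective (inj₂ refl) (inj₂ refl) _  = refl

  -- An element is coded by its value under `c` together with its code inside that fibre.
  fibres-↣ : (c : A → B) → (∀ y → Sub (λ x → c x ≡ y) ↣ C) → A ↣ (B × C)
  fibres-↣ c f = mk↣ {to = λ x → c x , to (f (c x)) (x , ∣ refl ∣)}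
    λ {x} {y} eq → same (cong proj₁ eq) refl (cong proj₂ eq)
    where
    same : ∀ {x y z} (e : c x ≡ z) (e′ : c y ≡ z) →
           to (f (c x)) (x , ∣ refl ∣) ≡ to (f (c y)) (y , ∣ refl ∣) → x ≡ y
    same {x} {y} e refl eq = cong proj₁ (injective (f (c y)) (trans (sym (move e)) eq))
      where
      move : ∀ {z} (e : c x ≡ z) → to (f (c x)) (x , ∣ refl ∣) ≡ to (f z) (x , ∣ e ∣)
      move refl = refl

  module Cover {A : Set a} {B : Set b} {I : Set r} {P : Pred A p} {D : I → Pred A q}
               (f : B ↣ Sub P) (cover : ∀ {x} → P x → ∃ λ i → D i x) where

    -- Choosing one index per element turns a cover of `P` into disjoint fibres on any `B` that
    -- embeds in `P`.
    index : B → I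
    index y = proj₁ (cover (out (proj₂ (to f y))))

    fibre-↣ : ∀ i → Sub (λ y → index y ≡ i) ↣ Sub (D i)
    fibre-↣ i = mk↣ {to = λ (y , e) → proj₁ (to f y) ,
                       ∣ subst (λ i → D i _) (out e) (proj₂ (cover (out (proj₂ (to f y))))) ∣}
      λ eq → ⟦⟧-≡ (injective f (⟦⟧-≡ (cong proj₁ eq)))

  cover-↣ : {P : Pred A p} {I : Set r} {D : I → Pred A q} → (∀ {x} → P x → ∃ λ i → D i x) →
            (∀ i → Sub (D i) ↣ C) → Sub P ↣ (I × C)
  cover-↣ cover f = fibres-↣ index λ i → f i ∘↣ fibre-↣ i
    where open Cover (↣-id _) cover

  -- Zermelo's well-ordering theorem

  module Zermelo (A : Set a) where

    Subset : Set a
    Subset = A → Bool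

    infix 4 _∈_ _⊑_
    infix 9 _⁺

    _∈_ : A → Subset → Set
    x ∈ S = T (S x)

    _⊑_ : Subset → Subset → Set a
    S ⊑ R = ∀ x → x ∈ S → x ∈ R

    Fresh : Subset → Pred A a
    Fresh S x = Lift a (¬ x ∈ S)

    choose : (P : Pred A a) → Satisfiable P → A
    choose = proj₁ (ac A)

    choose-fresh : ∀ S s → ¬ (choose (Fresh S) s ∈ S)
    choose-fresh S s = lower (proj₁ (proj₂ (ac A)) (Fresh S) s)

    choose-cong : ∀ {S R} s t → S ⊑ R → R ⊑ S → choose (Fresh S) s ≡ choose (Fresh R) t
    choose-cong {S} {R} s t S⊑R R⊑S = proj₂ (proj₂ (ac A)) (Fresh S) (Fresh R) s t
      ((λ (lift x∉S) → lift (x∉S ∘ R⊑S _)) , (λ (lift x∉R) → lift (x∉R ∘ S⊑R _)))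

    Next : Subset → Pred A a
    Next S x = x ∈ S ⊎ Σ[ s ∈ Satisfiable (Fresh S) ] x ≡ choose (Fresh S) s

    _⁺ : Subset → Subset
    (S ⁺) x = truth (Next S x)

    ⋃ : (Subset → Bool) → Subset
    ⋃ F x = truth (∃ λ S → T (F S) × x ∈ S)

    -- The least family closed under adjoining the chosen fresh element and under unions; the empty
    -- set enters as the union of the empty subfamily. Inclusion turns out to order it linearly.
    data Tower : Subset → Set a where
      succ  : ∀ {S} → Tower S → Tower (S ⁺)
      union : (F : Subset → Bool) → (∀ S → T (F S) → Tower S) → Tower (⋃ F)

    ⊑⁺ : ∀ S → S ⊑ S ⁺
    ⊑⁺ S x x∈S = ∣ inj₁ x∈S ∣

    ⁺-cong : ∀ {S R} → S ⊑ R → R ⊑ S → S ⁺ ⊑ R ⁺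
    ⁺-cong {S} {R} S⊑R R⊑S x x∈ with out {P = Next S x} x∈
    ... | inj₁ x∈S = ∣ inj₁ (S⊑R x x∈S) ∣
    ... | inj₂ ((y , lift y∉S) , x≡) = ∣ inj₂ (s , trans x≡ (choose-cong _ s S⊑R R⊑S)) ∣
      where s = y , lift (y∉S ∘ R⊑S y)

    -- As in the proof of the Bourbaki–Witt theorem.
    Extreme : Subset → Set a
    Extreme S = ∀ {R} → Tower R → R ⊑ S → ¬ (S ⊑ R) → R ⁺ ⊑ S

    -- Induction on the tower of `R`. Successors of proper subsets stay inside an extreme `S`; a
    -- union has a member above `S ⁺` or only members inside `S`.
    cut : ∀ {S R} → Extreme S → Tower R → R ⊑ S ⊎ S ⁺ ⊑ R
    cut {S} e (succ {R} t) with cut e t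
    ... | inj₂ S⁺⊑R = inj₂ λ x → ⊑⁺ R x ∘ S⁺⊑R x
    ... | inj₁ R⊑S with em {P = S ⊑ R}
    ...   | yes S⊑R = inj₂ (⁺-cong S⊑R R⊑S)
    ...   | no  S⋢R = inj₁ (e t R⊑S S⋢R)
    cut {S} e (union F ts) with em {P = ∃ λ R → T (F R) × S ⁺ ⊑ R}
    ... | yes (R , R∈F , S⁺⊑R) = inj₂ λ x x∈ → ∣ R , R∈F , S⁺⊑R x x∈ ∣
    ... | no none = inj₁ below
      where
      below : ⋃ F ⊑ S
      below x x∈ with R , R∈F , x∈R ← out {P = ∃ λ R → T (F R) × x ∈ R} x∈ with cut e (ts R R∈F)
      ... | inj₁ R⊑S  = R⊑S x x∈R
      ... | inj₂ S⁺⊑R = ⊥-elim (none (R , R∈F , S⁺⊑R))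

    extreme : ∀ {S} → Tower S → Extreme S
    extreme (succ {S} t) {R} u R⊑S⁺ S⁺⋢R with cut (extreme t) u
    ... | inj₂ S⁺⊑R = ⊥-elim (S⁺⋢R S⁺⊑R)
    ... | inj₁ R⊑S with em {P = S ⊑ R}
    ...   | yes S⊑R = ⁺-cong R⊑S S⊑R
    ...   | no  S⋢R = λ x → ⊑⁺ S x ∘ extreme t u R⊑S S⋢R x
    extreme (union F ts) {R} u R⊑⋃ ⋃⋢R with em {P = ∃ λ S → T (F S) × ¬ (S ⁺ ⊑ R)}
    ... | no none = ⊥-elim (⋃⋢R above)
      where
      above : ⋃ F ⊑ R
      above x x∈ with S , S∈F , x∈S ← out {P = ∃ λ S → T (F S) × x ∈ S} x∈ =
        dne λ x∉R → none (S , S∈F , λ S⁺⊑R → x∉R (S⁺⊑R x (⊑⁺ S x x∈S)))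
    ... | yes (S , S∈F , S⁺⋢R) with cut (extreme (ts S S∈F)) u
    ...   | inj₂ S⁺⊑R = ⊥-elim (S⁺⋢R S⁺⊑R)
    ...   | inj₁ R⊑S with em {P = S ⊑ R}
    ...     | no  S⋢R = λ x x∈ → ∣ S , S∈F , extreme (ts S S∈F) u R⊑S S⋢R x x∈ ∣
    -- Now `R` and `S` have the same elements, so `S ⁺` must be placed below the union; the union
    -- cannot lie inside `S`.
    ...     | yes S⊑R with cut (extreme (ts S S∈F)) (union F ts)
    ...       | inj₁ ⋃⊑S = ⊥-elim (⋃⋢R λ x → S⊑R x ∘ ⋃⊑S x)
    ...       | inj₂ S⁺⊑⋃ = λ x → S⁺⊑⋃ x ∘ ⁺-cong R⊑S S⊑R x

    -- The largest member of the tower that omits `x`. It determines `x`, as the element chosen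
    -- next.
    before : A → Subset
    before x = ⋃ λ S → truth (Tower S × ¬ (x ∈ S))

    before-tower : ∀ x → Tower (before x)
    before-tower x = union _ λ S → proj₁ ∘ out

    before-irrefl : ∀ x → ¬ (x ∈ before x)
    before-irrefl x x∈ with S , S∈ , x∈S ← out {P = ∃ λ S → ∥ Tower S × ¬ (x ∈ S) ∥ × x ∈ S} x∈ =
      proj₂ (out {P = Tower S × ¬ (x ∈ S)} S∈) x∈S

    before-max : ∀ {x S} → Tower S → ¬ (x ∈ S) → S ⊑ before x
    before-max t x∉S y y∈S = ∣ _ , ∣ t , x∉S ∣ , y∈S ∣

    before-fresh : ∀ x → Satisfiable (Fresh (before x))
    before-fresh x = x , lift (before-irrefl x)

    -- Otherwise `before x ⁺` would still omit `x`, against the maximality of `before x`.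
    before-next : ∀ x s → choose (Fresh (before x)) s ≡ x
    before-next x s = dne λ ≢x → choose-fresh (before x) s
      (before-max (succ (before-tower x)) (x∉ ≢x) _ ∣ inj₂ (s , refl) ∣)
      where
      x∉ : ¬ (choose (Fresh (before x)) s ≡ x) → ¬ (x ∈ before x ⁺)
      x∉ ≢x x∈ with out {P = Next (before x) x} x∈
      ... | inj₁ x∈before = before-irrefl x x∈before
      ... | inj₂ (t , x≡) = ≢x (trans (choose-cong s t (λ _ → id) (λ _ → id)) (sym x≡))

    self∈ : ∀ x → x ∈ before x ⁺
    self∈ x = ∣ inj₂ (before-fresh x , sym (before-next x _)) ∣

    before-total : ∀ x y → x ∈ before y ⊎ x ≡ y ⊎ y ∈ before x
    before-total x y with cut (extreme (before-tower x)) (before-tower y)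
                        | cut (extreme (before-tower y)) (before-tower x)
    ... | inj₂ x⁺⊑y | _         = inj₁ (x⁺⊑y x (self∈ x))
    ... | inj₁ _    | inj₂ y⁺⊑x = inj₂ (inj₂ (y⁺⊑x y (self∈ y)))
    ... | inj₁ y⊑x  | inj₁ x⊑y  = inj₂ (inj₁ (trans (sym (before-next x (before-fresh x)))
          (trans (choose-cong (before-fresh x) (before-fresh y) x⊑y y⊑x) (before-next y (before-fresh y)))))

    Before : Rel A 0ℓ
    Before x y = x ∈ before y

    -- Induction on the tower: the element adjoined to `S` has all its predecessors in `S`.
    tower-accessible : ∀ {S} → Tower S → ∀ x → x ∈ S → Acc Before x
    tower-accessible (succ {S} t) x x∈ with out {P = Next S x} x∈
    ... | inj₁ x∈S = tower-accessible t x x∈S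
    ... | inj₂ (s , refl) = acc λ {y} y∈before → tower-accessible t y (before⊑S y y∈before)
      where
      before⊑S : before x ⊑ S
      before⊑S with cut (extreme t) (before-tower x)
      ... | inj₁ before⊑S = before⊑S
      ... | inj₂ S⁺⊑before = ⊥-elim (before-irrefl x (S⁺⊑before x x∈))
    tower-accessible (union F ts) x x∈ with S , S∈F , x∈S ← out {P = ∃ λ S → T (F S) × x ∈ S} x∈ =
      tower-accessible (ts S S∈F) x x∈S

    wellOrder : WellOrder A
    wellOrder = record
      { _<_   = Before
      ; total = before-total
      ; wf    = λ x → tower-accessible (succ (before-tower x)) x (self∈ x)
      }

  opaque
    zermelo : (A : Set a) → WellOrder A
    zermelo = Zermelo.wellOrder

  -- Selections along a well-order

  module Order {A : Set a} (wo : WellOrder A) where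
    open WellOrder wo

    least : (P : Pred A p) → Satisfiable P → ∃ λ x → P x × ∀ y → y < x → ¬ P y
    least P (x , px) = dne λ none → go none x (wf x) px
      where
      go : ¬ (∃ λ x → P x × ∀ y → y < x → ¬ P y) → ∀ x → Acc _<_ x → ¬ P x
      go none x (acc rs) px = none (x , px , λ y y<x → go none y (rs y<x))

    Seg : A → Set a
    Seg x = Sub (λ y → y < x)

    closed-segment : ∀ x → Sub (λ y → y ≤ x) ↣ Maybe (Seg x)
    closed-segment x = adjoin

    module Greedy (R : Rel A r) where

      -- Along the order, `x` is taken exactly when it is related to everything taken earlier. The
      -- recursion is on accessibility proofs.
      Greedy′ : ∀ {x} → Acc _<_ x → Set (a ⊔ r)
      Greedy′ {x} (acc rs) = ∀ y (y<x : y < x) → Greedy′ (rs y<x) → R x y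

      Greedy′-irrelevant : ∀ {x} (s t : Acc _<_ x) → Greedy′ s → Greedy′ t
      Greedy′-irrelevant (acc rs) (acc rt) gx y y<x gy =
        -- `Greedy′` occurs negatively in itself, so the two accessibility proofs change places.
        gx y y<x (Greedy′-irrelevant (rt y<x) (rs y<x) gy)

      Greedy : Pred A (a ⊔ r)
      Greedy x = Greedy′ (wf x)

      greedy-related : ∀ {x y} → Greedy x → y < x → Greedy y → R x y
      greedy-related {x} {y} gx y<x gy with acc rs ← wf x =
        gx y y<x (Greedy′-irrelevant (wf y) (rs y<x) gy)

      greedy-maximal : ∀ {x} → (∀ y → y < x → Greedy y → R x y) → Greedy x
      greedy-maximal {x} related with acc rs ← wf x =
        λ y y<x gy → related y y<x (Greedy′-irrelevant (rs y<x) (wf y) gy)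

  pullback : A ↣ B → WellOrder B → WellOrder A
  pullback {A = A} f wo = record { _<_ = _⊏_ ; total = total′ ; wf = λ x → lift-acc (wf (to f x)) }
    where
    open WellOrder wo
    _⊏_ : Rel A 0ℓ
    x ⊏ y = to f x < to f y
    total′ : ∀ x y → x ⊏ y ⊎ x ≡ y ⊎ y ⊏ x
    total′ x y with total (to f x) (to f y)
    ... | inj₁ x<y        = inj₁ x<y
    ... | inj₂ (inj₁ x≡y) = inj₂ (inj₁ (injective f x≡y))
    ... | inj₂ (inj₂ y<x) = inj₂ (inj₂ y<x)
    lift-acc : ∀ {x} → Acc _<_ (to f x) → Acc _⊏_ x
    lift-acc (acc rs) = acc λ y<x → lift-acc (rs y<x)

  module Lexicographic {A : Set a} {B : Set b} (wo : WellOrder B) (ρ : A → B)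
                       (layer : ∀ y → WellOrder (Sub λ x → ρ x ≡ y)) where
    open WellOrder wo
    module Layer y = WellOrder (layer y)

    Lex : Rel A b
    Lex x y = ρ x < ρ y ⊎ Σ[ e ∈ ρ x ≡ ρ y ] Layer._<_ (ρ y) (x , ∣ e ∣) (y , ∣ refl ∣)

    lexTotal : ∀ x y → ∥ Lex x y ∥ ⊎ x ≡ y ⊎ ∥ Lex y x ∥
    lexTotal x y with total (ρ x) (ρ y)
    ... | inj₁ ρx<ρy        = inj₁ ∣ inj₁ ρx<ρy ∣
    ... | inj₂ (inj₂ ρy<ρx) = inj₂ (inj₂ ∣ inj₁ ρy<ρx ∣)
    ... | inj₂ (inj₁ e) with Layer.total (ρ y) (x , ∣ e ∣) (y , ∣ refl ∣)
    ...   | inj₁ x<y        = inj₁ ∣ inj₂ (e , x<y) ∣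
    ...   | inj₂ (inj₁ x≡y) = inj₂ (inj₁ (cong proj₁ x≡y))
    ...   | inj₂ (inj₂ y<x) = inj₂ (inj₂ ∣ inj₂ (sym e , move e ∣ e ∣ y<x) ∣)
      where
      move : ∀ {z} (e : ρ x ≡ z) (m : ∥ ρ x ≡ z ∥) {n : ∥ ρ y ≡ z ∥} → Layer._<_ z (y , n) (x , m) →
             ∀ {n′} → Layer._<_ (ρ x) (y , n′) (x , ∣ refl ∣)
      move refl m {n} y<x {n′} rewrite T-irrelevant ∣ refl {x = ρ x} ∣ m | T-irrelevant n′ n = y<x

    AccLex : Pred A _
    AccLex = Acc λ x y → ∥ Lex x y ∥

    lex-accessible : ∀ {z} → Acc _<_ z → ∀ {x} → ρ x ≡ z → AccLex x
    layer-accessible : ∀ {x} → (∀ {y} → ρ y < ρ x → AccLex y) →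
                       ∀ {x′} (e : ∥ ρ x′ ≡ ρ x ∥) → Acc (Layer._<_ (ρ x)) (x′ , e) → AccLex x′

    lex-accessible (acc rs) {x} refl =
      layer-accessible (λ {y} ρy<ρx → lex-accessible (rs ρy<ρx) refl) ∣ refl ∣ (Layer.wf (ρ x) _)

    layer-accessible {x} below {x′} e (acc rt) = acc λ {y} y⊏x′ → step y (out y⊏x′) (out e)
      where
      step : ∀ y → Lex y x′ → ρ x′ ≡ ρ x → AccLex y
      step y (inj₁ ρy<) e′ = below (subst (ρ y <_) e′ ρy<)
      step y (inj₂ (e″ , y<x′)) e′ = layer-accessible below ∣ trans e″ e′ ∣ (rt (move e′ e e″ y<x′))
        where
        move : ∀ {z} (e′ : ρ x′ ≡ z) (e : ∥ ρ x′ ≡ z ∥) (e″ : ρ y ≡ ρ x′) →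
               Layer._<_ (ρ x′) (y , ∣ e″ ∣) (x′ , ∣ refl ∣) →
               Layer._<_ z (y , ∣ trans e″ e′ ∣) (x′ , e)
        move refl e e″ y<x′ rewrite T-irrelevant e ∣ refl {x = ρ x′} ∣
          | T-irrelevant ∣ trans e″ refl ∣ ∣ e″ ∣ = y<x′

    lexicographic : WellOrder A
    lexicographic = record
      { _<_   = λ x y → ∥ Lex x y ∥
      ; total = lexTotal
      ; wf    = λ x → lex-accessible (wf (ρ x)) refl
      }

  -- The greedy clique for the lexicographic order of Σ B F picks exactly one
  -- element of each fibre; this replaces a recursion along B, which would need
  -- function extensionality to be coherent.
  module Transfinite {B : Set b} (wo : WellOrder B) (F : B → Set ℓ′)
                     (R : ∀ {x y} → F x → F y → Set r) where
    open WellOrder wo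
    open Order wo using (Seg)

    private
      module L = Lexicographic wo (proj₁ {B = F}) (λ y → pullback inclusion (zermelo (Σ B F)))
      module W = WellOrder L.lexicographic
      -- Distinct elements of one fibre are incompatible, so a clique meets each fibre at most once.
      S : Rel (Σ B F) _
      S (x , s) (y , t) = x ≢ y × R s t
      open Order.Greedy L.lexicographic S

    unique : ∀ {x} {s t : F x} → Greedy (x , s) → Greedy (x , t) → s ≡ t
    unique {x} {s} {t} gs gt with W.total (x , s) (x , t)
    ... | inj₁ s<t         = ⊥-elim (proj₁ (greedy-related gt s<t gs) refl)
    ... | inj₂ (inj₁ refl) = refl
    ... | inj₂ (inj₂ t<s)  = ⊥-elim (proj₁ (greedy-related gs t<s gt) refl)

    opaque
      transfinite : (∀ x (s : (y : Seg x) → F (proj₁ y)) → ∃ λ t → ∀ y → R {x} t (s y)) →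
                    Σ[ s ∈ (∀ x → F x) ] (∀ {x y} → y < x → R (s x) (s y))
      transfinite extend = (λ x → proj₁ (pick x)) , λ {x} {y} y<x →
        proj₂ (greedy-related (proj₂ (pick x)) ∣ inj₁ y<x ∣ (proj₂ (pick y)))
        where
        go : ∀ x → Acc _<_ x → ∃ λ t → Greedy (x , t)
        -- If the fibre over `x` had no greedy element, the extension `t` would be greedy: earlier
        -- greedy elements lie in earlier fibres, where by `unique` they are the values of `s`.
        go x (acc rs) = dne λ none → none (t , greedy-maximal λ z z< → chosen none z (out z<))
          where
          s : (y : Seg x) → ∃ λ t → Greedy (proj₁ y , t)
          s (y , y<x) = go y (rs (out y<x))
          t : F x
          t = proj₁ (extend x (proj₁ ∘ s))
          related : ∀ y → R t (proj₁ (s y))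
          related = proj₂ (extend x (proj₁ ∘ s))
          chosen : ¬ (∃ λ t → Greedy (x , t)) → ∀ z → L.Lex z (x , t) → Greedy z → S (x , t) z
          chosen none (y , u) (inj₂ (refl , _)) gz = ⊥-elim (none (u , gz))
          chosen none (y , u) (inj₁ y<x) gz = (λ { refl → irrefl y<x }) ,
            subst (R t) (unique (proj₂ (s (y , ∣ y<x ∣))) gz) (related (y , ∣ y<x ∣))

        pick : ∀ x → ∃ λ t → Greedy (x , t)
        pick x = go x (wf x)

  Clique : Rel A r → Pred A p → Set _
  Clique R K = ∀ {x y} → K x → K y → x ≢ y → R x y

  opaque
    maximalClique : {A : Set a} (R : Rel A r) → Symmetric R →
                    Σ[ K ∈ Pred A (a ⊔ r) ] (Clique R K × ∀ x → (∀ y → K y → x ≢ y → R x y) → K x)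
    maximalClique {A = A} R R-sym = Greedy , clique , λ x related →
        greedy-maximal λ y y<x gy → related y gy λ { refl → irrefl y<x }
      where
      open WellOrder (zermelo A)
      open Order.Greedy (zermelo A) R
      clique : Clique R Greedy
      clique {x} {y} gx gy x≢y with total x y
      ... | inj₁ x<y        = R-sym (greedy-related gy x<y gx)
      ... | inj₂ (inj₁ x≡y) = ⊥-elim (x≢y x≡y)
      ... | inj₂ (inj₂ y<x) = greedy-related gx y<x gy

  -- Comparison of cardinalities

  module MaximalChoices {I : Set ℓ} (X : I → Set ℓ) (U : Pred (∀ i → X i) ℓ)
    (disjoint : ∀ {f g} → U f → U g → f ≢ g → ∀ i → f i ≢ g i)
    (maximal : ∀ f → (∀ g → U g → f ≢ g → ∀ i → f i ≢ g i) → U f) where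

    Onto : Pred I ℓ
    Onto i = ∀ x → ∃ λ f → U f × f i ≡ x

    onto⇒least : ∀ {i} → Onto i → ∀ j → X i ↣ X j
    onto⇒least {i} onto j = mk↣ {to = λ x → proj₁ (onto x) j} λ {x} {y} → inj (onto x) (onto y)
      where
      inj : ∀ {x y} (h : ∃ λ f → U f × f i ≡ x) (h′ : ∃ λ f → U f × f i ≡ y) →
            proj₁ h j ≡ proj₁ h′ j → x ≡ y
      inj (f , Uf , refl) (g , Ug , refl) eq = cong (λ h → h i) (dne λ f≢g → disjoint Uf Ug f≢g j eq)

    -- If every projection missed a value, the missed values would form a choice function that
    -- belongs to `U` by maximality.
    some-onto : I → ∃ Onto
    some-onto i₀ = dne λ none →
      let missed : ∀ i → ∃ λ x → ¬ (∃ λ f → U f × f i ≡ x)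
          missed i = ¬∀⇒∃¬ λ onto → none (i , onto)
      in proj₂ (missed i₀)
           (_ , maximal (proj₁ ∘ missed) (λ g Ug _ i eq → proj₂ (missed i) (g , Ug , sym eq)) , refl)

  opaque
    -- Take a maximal family of choice functions that disagree everywhere: one of
    -- the projections must be onto, and its factor then embeds into all others.
    leastCardinal : {I : Set ℓ} → I → (X : I → Set ℓ) → ∃ λ i → ∀ j → X i ↣ X j
    leastCardinal i₀ X =
      let U , disjoint , maximal = maximalClique (λ f g → ∀ i → f i ≢ g i) (λ f#g i → f#g i ∘ sym)
          i , onto = MaximalChoices.some-onto X U disjoint maximal i₀
      in i , MaximalChoices.onto⇒least X U disjoint maximal onto

  opaque
    comparable : (A B : Set ℓ) → A ↣ B ⊎ B ↣ A
    comparable {ℓ} A B with leastCardinal {I = Lift ℓ Bool} (lift true) (λ (lift i) → if i then A else B)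
    ... | lift true  , A≼ = inj₁ (A≼ (lift false))
    ... | lift false , B≼ = inj₂ (B≼ (lift true))

  ≰⇒≥ : {A B : Set ℓ} → ¬ (A ↣ B) → B ↣ A
  ≰⇒≥ {A = A} {B = B} A⋠B = [ ⊥-elim ∘ A⋠B , id ]′ (comparable A B)

  image-↣ : {f : A → B} → Sub (λ y → ∃ λ x → f x ≡ y) ↣ A
  image-↣ {A = A} {B = B} {f} = mk↣ {to = λ (y , h) → proj₁ (hit h)} λ {(y , h)} {(z , h′)} eq →
      ⟦⟧-≡ (trans (sym (proj₂ (hit h))) (trans (cong f eq) (proj₂ (hit h′))))
    where
    hit : ∀ {y} → ∥ ∃ (λ x → f x ≡ y) ∥ → ∃ λ x → f x ≡ y
    hit = out

  ↣-image : (f : A ↣ B) → A ↣ Sub (λ y → ∃ λ x → to f x ≡ y)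
  ↣-image f = mk↣ {to = λ x → to f x , ∣ x , refl ∣} λ eq → injective f (cong proj₁ eq)

  opaque
    -- The types satisfying `Ψ` form a large class, but those that embed in `X` are represented by
    -- subsets of `X`, and all others lie above `X`.
    leastSuch : ∀ {ℓ q} (Ψ : Set ℓ → Set q) {X : Set ℓ} → Ψ X → ∃ λ Y → Ψ Y × ∀ Z → Ψ Z → Y ↣ Z
    leastSuch {ℓ} {q} Ψ {X} ΨX =
      let (S , rep) , least = leastCardinal {I = Σ[ S ∈ (X → Bool) ] ∥ Represents S ∥}
            (_ , ∣ represent ΨX (↣-id X) ∣) (λ (S , _) → ⟦ S ⟧)
          Y , Y≼S , _ , ΨY = out {P = Represents S} rep
      in Y , ΨY , λ Z ΨZ →
           [ (λ Z≼X → image-↣ ∘↣ least (_ , ∣ represent ΨZ Z≼X ∣) ∘↣ Y≼S)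
           , (λ X≼Z → X≼Z ∘↣ inclusion ∘↣ Y≼S) ]′ (comparable Z X)
      where
      Represents : (X → Bool) → Set (lsuc ℓ ⊔ q)
      Represents S = ∃ λ Y → Y ↣ ⟦ S ⟧ × ⟦ S ⟧ ↣ Y × Ψ Y

      represent : ∀ {Z} → Ψ Z → (f : Z ↣ X) → Represents (λ x → truth (∃ λ z → to f z ≡ x))
      represent ΨZ f = _ , ↣-image f , image-↣ , ΨZ

  -- A counterexample of least cardinality is impossible; `¬ (X ↣ Y)` expresses that `Y` is smaller
  -- than `X`.
  cardinalInduction : (Φ : Set ℓ → Set q) → (∀ X → (∀ Y → ¬ (X ↣ Y) → Φ Y) → Φ X) → ∀ X → Φ X
  cardinalInduction Φ step X = dne λ ¬ΦX →
    let Y , ¬ΦY , least-Y = leastSuch (λ Z → ¬ Φ Z) ¬ΦX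
    in ¬ΦY (step Y λ Z Y⋠Z → dne λ ¬ΦZ → Y⋠Z (least-Y Z ¬ΦZ))

  opaque
    -- If some segment is as large as `A`, take the least such `x` and pull the order back along an
    -- embedding of `A` into it. New segments embed in segments of elements below `x`.
    initialOrder : (A : Set ℓ) → Σ[ wo ∈ WellOrder A ] (∀ x → ¬ (A ↣ Order.Seg wo x))
    initialOrder A with em {P = ∃ λ x → A ↣ Order.Seg (zermelo A) x}
    ... | no  none  = zermelo A , λ x A≼ → none (x , A≼)
    ... | yes large with x , A≼ , minimal ← Order.least (zermelo A) _ large =
      pullback f (zermelo A) , λ y A≼′ →
        minimal (to f y) (out (proj₂ (to A≼ y))) (Sub-map f id ∘↣ A≼′)
      where
      f : A ↣ A
      f = inclusion ∘↣ A≼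

  -- Each element of A takes a value not used before.
  opaque
    segments-embed : {A B : Set ℓ} (wo : WellOrder A) → (∀ x → ¬ (B ↣ Order.Seg wo x)) → A ↣ B
    segments-embed {A = A} {B} wo short = mk↣ {to = f} f-injective
      where
      open WellOrder wo
      open Transfinite wo (λ _ → B) _≢_
      fresh : ∀ x (s : Order.Seg wo x → B) → ∃ λ t → ∀ y → t ≢ s y
      fresh x s = dne λ none →
        let used : ∀ t → ∃ λ y → t ≡ s y
            used t = dne λ ¬used → none (t , λ y eq → ¬used (y , eq))
        in short x (mk↣ {to = λ t → proj₁ (used t)} λ {t} {u} eq →
             trans (proj₂ (used t)) (trans (cong s eq) (sym (proj₂ (used u)))))
      f : A → B
      f = proj₁ (transfinite fresh)
      f-injective : Injective _≡_ _≡_ f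
      f-injective {x} {y} eq with total x y
      ... | inj₁ x<y        = ⊥-elim (proj₂ (transfinite fresh) x<y (sym eq))
      ... | inj₂ (inj₁ x≡y) = x≡y
      ... | inj₂ (inj₂ y<x) = ⊥-elim (proj₂ (transfinite fresh) y<x eq)

  -- Finite and infinite types

  increasing⇒injective : {h : ℕ → ℕ} → (∀ n → h n ℕ.< h (suc n)) → Injective _≡_ _≡_ h
  increasing⇒injective {h} step {m} {n} eq = compare (ℕ.<-cmp m n)
    where
    mono : ∀ {m n} → m ℕ.< n → h m ℕ.< h n
    mono {m} {suc n} m<1+n with ℕ.m≤n⇒m<n∨m≡n (ℕ.s≤s⁻¹ m<1+n)
    ... | inj₁ m<n  = ℕ.<-trans (mono m<n) (step n)
    ... | inj₂ refl = step n
    compare : Tri (m ℕ.< n) (m ≡ n) (n ℕ.< m) → m ≡ n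
    compare (tri< m<n _ _) = ⊥-elim (ℕ.<-irrefl eq (mono m<n))
    compare (tri≈ _ m≡n _) = m≡n
    compare (tri> _ _ n<m) = ⊥-elim (ℕ.<-irrefl (sym eq) (mono n<m))

  opaque
    -- If `A` embeds in the natural numbers with unbounded codes, repeatedly picking an element with
    -- a larger code gives a sequence without repetitions.
    ℕ-or-Fin : (A : Set ℓ) → ℕ ↣ A ⊎ ∃ λ n → A ↣ Fin n
    ℕ-or-Fin {ℓ} A with comparable (Lift ℓ ℕ) A
    ... | inj₁ f = inj₁ (f ∘↣ mk↣ {to = lift} (cong lower))
    ... | inj₂ f with em {P = ∃ λ n → ∀ x → lower (to f x) ℕ.< n}
    ...   | yes (n , bounded) = inj₂ (n , mk↣ {to = λ x → fromℕ< (bounded x)}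
              λ {x} {y} eq → injective f (cong lift (fromℕ<-injective _ _ (bounded x) (bounded y) eq)))
    ...   | no unbounded = inj₁ (mk↣ {to = s} (increasing⇒injective s-increasing ∘ cong code))
      where
      code : A → ℕ
      code x = lower (to f x)
      above : ∀ n → ∃ λ x → ¬ (code x ℕ.< n)
      above n = ¬∀⇒∃¬ λ bounded → unbounded (n , bounded)
      s : ℕ → A
      s zero    = proj₁ (above zero)
      s (suc n) = proj₁ (above (suc (code (s n))))
      s-increasing : ∀ n → code (s n) ℕ.< code (s (suc n))
      s-increasing n = ℕ.≮⇒≥ (proj₂ (above (suc (code (s n)))))

  -- Missed values are punched out one at a time until the injection is onto.
  Fin-bijection : ∀ n → A ↣ Fin n → ∃ λ m → A ⤖ Fin m
  Fin-bijection zero f = zero , mk⤖ {to = to f} (injective f , λ ())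
  Fin-bijection (suc n) f with em {P = ∀ i → ∃ λ x → to f x ≡ i}
  ... | yes onto = suc n , mk⤖ {to = to f} (injective f , λ i → proj₁ (onto i) , λ { refl → proj₂ (onto i) })
  ... | no ¬onto with i , missed ← ¬∀⇒∃¬ ¬onto =
    Fin-bijection n (mk↣ {to = λ x → punchOut (i≢ x)} λ {x} {y} eq →
      injective f (punchOut-injective (i≢ x) (i≢ y) eq))
    where
    i≢ : ∀ x → i ≢ to f x
    i≢ x eq = missed (x , sym eq)

  infinite⇒ℕ↣ : {A : Set ℓ} → Infinite A → ℕ ↣ A
  infinite⇒ℕ↣ {A = A} inf with ℕ-or-Fin A
  ... | inj₁ f       = f
  ... | inj₂ (n , f) = ⊥-elim (inf (Fin-bijection n f))

  ℕ⋠Fin : ∀ {n} → ¬ (ℕ ↣ Fin n)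
  ℕ⋠Fin f = ℕ→Fin-notInjective (to f) (injective f)

  Maybe-↣ : A ↣ B → Maybe A ↣ Maybe B
  Maybe-↣ f = mk↣ {to = Maybe.map (to f)} (map-injective (injective f))

  Maybe-Fin : ∀ {n} → Maybe (Fin n) ↣ Fin (suc n)
  Maybe-Fin {n} = mk↣ {to = enc} inj
    where
    enc : Maybe (Fin n) → Fin (suc n)
    enc (just i) = suc i
    enc nothing  = zero
    inj : Injective _≡_ _≡_ enc
    inj {just i}  {just j}  eq = cong just (suc-injective eq)
    inj {nothing} {nothing} _  = refl

  _×↣_ : A ↣ C → B ↣ D → (A × B) ↣ (C × D)
  f ×↣ g = mk↣ {to = λ (x , y) → to f x , to g y} λ eq →
    cong₂ _,_ (injective f (cong proj₁ eq)) (injective g (cong proj₂ eq))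

  ×-Fin : ∀ {m n} → (Fin m × Fin n) ↣ Fin (m ℕ.* n)
  ×-Fin = mk↣ {to = λ (i , j) → combine i j} λ {(i , j)} {(k , l)} eq →
    let i≡k , j≡l = combine-injective i j k l eq in cong₂ _,_ i≡k j≡l

  -- Hilbert's hotel: the elements `to ι n` move up by one and make room for `nothing`.
  Maybe-absorb : ℕ ↣ A → Maybe A ↣ A
  Maybe-absorb {A = A} ι = mk↣ {to = shift} λ {x} {y} → shift-injective x y
    where
    shiftDec : (x : A) → Dec (∃ λ n → to ι n ≡ x) → A
    shiftDec x (yes (n , _)) = to ι (suc n)
    shiftDec x (no _)        = x

    shift : Maybe A → A
    shift nothing  = to ι zero
    shift (just x) = shiftDec x em

    shiftDec≢zero : ∀ x d → shiftDec x d ≢ to ι zero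
    shiftDec≢zero x (yes (n , _)) eq with () ← injective ι eq
    shiftDec≢zero x (no none) eq = none (zero , sym eq)

    shiftDec-injective : ∀ x y d e → shiftDec x d ≡ shiftDec y e → x ≡ y
    shiftDec-injective x y (yes (m , refl)) (yes (n , refl)) eq with refl ← injective ι eq = refl
    shiftDec-injective x y (yes (m , _))    (no none)        eq = ⊥-elim (none (suc m , eq))
    shiftDec-injective x y (no none)        (yes (n , _))    eq = ⊥-elim (none (suc n , sym eq))
    shiftDec-injective x y (no _)           (no _)           eq = eq

    shift-injective : ∀ x y → shift x ≡ shift y → x ≡ y
    shift-injective nothing  nothing  _  = refl
    shift-injective nothing  (just y) eq = ⊥-elim (shiftDec≢zero y em (sym eq))
    shift-injective (just x) nothing  eq = ⊥-elim (shiftDec≢zero x em eq)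
    shift-injective (just x) (just y) eq = cong just (shiftDec-injective x y em em eq)

  -- Order κ × κ by the maximum first: a proper initial segment lies in the
  -- square of a closed segment of κ, hence has fewer than κ elements.
  hessenberg : (κ : Set ℓ) → ℕ ↣ κ → (κ × κ) ↣ κ
  hessenberg = cardinalInduction (λ κ → ℕ ↣ κ → (κ × κ) ↣ κ) step
    where
    step : (κ : Set ℓ) → ((Y : Set ℓ) → ¬ (κ ↣ Y) → ℕ ↣ Y → (Y × Y) ↣ Y) → ℕ ↣ κ → (κ × κ) ↣ κ
    step κ ih ι = segments-embed lexicographic short
      where
      wo = proj₁ (initialOrder κ)
      open WellOrder wo
      open Order wo

      max : κ × κ → κ
      max (x , y) with total x y
      ... | inj₁ x<y = y
      ... | inj₂ _   = x

      ≤max : ∀ x y → x ≤ max (x , y) × y ≤ max (x , y)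
      ≤max x y with total x y
      ... | inj₁ x<y        = inj₁ x<y , inj₂ refl
      ... | inj₂ (inj₁ x≡y) = inj₂ refl , inj₂ (sym x≡y)
      ... | inj₂ (inj₂ y<x) = inj₂ refl , inj₁ y<x

      open Lexicographic wo max (λ _ → pullback inclusion (zermelo (κ × κ)))

      square : ∀ z → Order.Seg lexicographic z ↣
                     (Sub (λ x → x ≤ max z) × Sub (λ x → x ≤ max z))
      square z = mk↣ {to = λ ((x , y) , l) → (x , ∣ ≤-trans (proj₁ (≤max x y)) (below (out (out l))) ∣)
                                         , (y , ∣ ≤-trans (proj₂ (≤max x y)) (below (out (out l))) ∣)}
        λ eq → ⟦⟧-≡ (cong₂ _,_ (cong (proj₁ ∘ proj₁) eq) (cong (proj₁ ∘ proj₂) eq))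
        where
        below : ∀ {w} → Lex w z → max w ≤ max z
        below (inj₁ l)       = inj₁ l
        below (inj₂ (e , _)) = inj₂ e

      short : ∀ z → ¬ (κ ↣ Order.Seg lexicographic z)
      -- An infinite segment absorbs its endpoint and its square, the latter by the induction
      -- hypothesis; a finite one has a finite square, which cannot contain the infinite `κ`.
      short z κ≼ with ℕ-or-Fin (Seg (max z))
      ... | inj₁ ι′ = proj₂ (initialOrder κ) (max z)
              (ih (Seg (max z)) (proj₂ (initialOrder κ) (max z)) ι′ ∘↣ (f ×↣ f) ∘↣ square z ∘↣ κ≼)
        where f = Maybe-absorb ι′ ∘↣ closed-segment (max z)
      ... | inj₂ (n , g) = ℕ⋠Fin (×-Fin ∘↣ (f ×↣ f) ∘↣ square z ∘↣ κ≼ ∘↣ ι)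
        where f = Maybe-Fin ∘↣ Maybe-↣ g ∘↣ closed-segment (max z)

  -- Sets of fewer than `μ` elements

  module Smallness (μ : Set ℓ) (ι : ℕ ↣ μ) where

    -- By comparability this means cardinality below `μ` at level `ℓ`; the negative form makes sense
    -- at every level.
    Small : Set a → Set (ℓ ⊔ a)
    Small Y = ¬ (μ ↣ Y)

    small-↣ : A ↣ B → Small B → Small A
    small-↣ f small μ≼ = small (f ∘↣ μ≼)

    small-Fin : ∀ {n} → A ↣ Fin n → Small A
    small-Fin f μ≼ = ℕ⋠Fin (f ∘↣ μ≼ ∘↣ ι)

    module _ {X : Set ℓ} where

      small-Maybe : Small X → Small (Maybe X)
      small-Maybe small with ℕ-or-Fin X
      ... | inj₁ ι′      = small-↣ (Maybe-absorb ι′) small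
      ... | inj₂ (n , f) = small-Fin (Maybe-Fin ∘↣ Maybe-↣ f)

      small-square : Small X → Small (X × X)
      small-square small with ℕ-or-Fin X
      ... | inj₁ ι′      = small-↣ (hessenberg X ι′) small
      ... | inj₂ (n , f) = small-Fin (×-Fin ∘↣ (f ×↣ f))

    module _ {X Y : Set ℓ} where

      small-× : Small X → Small Y → Small (X × Y)
      small-× smallX smallY with comparable X Y
      ... | inj₁ f = small-↣ (f ×↣ ↣-id Y) (small-square smallY)
      ... | inj₂ f = small-↣ (↣-id X ×↣ f) (small-square smallX)

    module _ {X Y : Set ℓ} where

      small-⊎ : Small X → Small Y → Small (X ⊎ Y)
      small-⊎ smallX smallY = small-↣ f (small-× (small-Maybe smallX) (small-Maybe smallY))
        where
        enc : X ⊎ Y → Maybe X × Maybe Y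
        enc (inj₁ x) = just x , nothing
        enc (inj₂ y) = nothing , just y
        enc-injective : Injective _≡_ _≡_ enc
        enc-injective {inj₁ _} {inj₁ _} refl = refl
        enc-injective {inj₂ _} {inj₂ _} refl = refl
        f : (X ⊎ Y) ↣ (Maybe X × Maybe Y)
        f = mk↣ {to = enc} enc-injective

    module _ {A : Set ℓ} where

      small-∪ : {P : Pred A p} {Q : Pred A q} {R : Pred A r} → (∀ {x} → R x → P x ⊎ Q x) →
                Small (Sub P) → Small (Sub Q) → Small (Sub R)
      small-∪ {P = P} {Q} {R} cover smallP smallQ = small-↣
        (mk↣ {to = λ (x , Rx) → side (cover (out Rx))}
             λ {(x , Rx)} {(y , Ry)} eq → ⟦⟧-≡ (trans (sym (side-proj (cover (out Rx))))
               (trans (cong [ proj₁ , proj₁ ]′ eq) (side-proj (cover (out Ry))))))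
        (small-⊎ smallP smallQ)
        where
        side : ∀ {x} → P x ⊎ Q x → Sub P ⊎ Sub Q
        side (inj₁ Px) = inj₁ (_ , ∣ Px ∣)
        side (inj₂ Qx) = inj₂ (_ , ∣ Qx ∣)
        side-proj : ∀ {x} (c : P x ⊎ Q x) → [ proj₁ , proj₁ ]′ (side c) ≡ x
        side-proj (inj₁ _) = refl
        side-proj (inj₂ _) = refl

      -- Serves to show that the cofinality of `μ` is infinite. Fibres are added one code at a time,
      -- each union of two small sets being small.
      small-finite-fibres : {I : Set ℓ} {c : A → I} {n : ℕ} → I ↣ Fin n →
                            (∀ i → Small (Sub λ x → c x ≡ i)) → Small A
      small-finite-fibres {I = I} {c} {n} f fibres =
        small-↣ (mk↣ {to = λ x → x , ∣ toℕ<n (to f (c x)) ∣} (cong proj₁)) (below n)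
        where
        code : A → ℕ
        code x = toℕ (to f (c x))
        level : ∀ m → Small (Sub λ x → code x ≡ m)
        -- An element of the level identifies the one fibre that the level consists of; `ι` supplies
        -- such an element.
        level m μ≼ with x , e ← to μ≼ (to ι zero) =
          fibres (c x) (Sub-mono (λ e′ → injective f (toℕ-injective (trans e′ (sym (out e))))) ∘↣ μ≼)
        below : ∀ m → Small (Sub λ x → code x ℕ.< m)
        below zero μ≼ with () ← out (proj₂ (to μ≼ (to ι zero)))
        below (suc m) = small-∪ (ℕ.m≤n⇒m<n∨m≡n ∘ ℕ.s≤s⁻¹) (below m) (level m)

  -- The Dushnik–Miller theorem

  module DushnikMiller {V : Set ℓ} (R : Rel V r) (R-sym : Symmetric R) where

    Apart : Rel V _
    Apart x y = x ≢ y × ¬ R x y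

    IndependentSequence : Pred V p → Set _
    IndependentSequence P =
      Σ[ s ∈ (ℕ → V) ] (∀ n → P (s n)) × (∀ {m n} → m ℕ.< n → Apart (s m) (s n))

    Non : Pred V 0ℓ → V → Pred V 0ℓ
    Non S x y = ∥ S y × Apart x y ∥

    -- If every big `S` has a point with `Non S x` big, iterating this passage produces the
    -- sequence. `Big` is abstract because two notions of size are used.
    core : (Big : Pred (Pred V 0ℓ) q) {P : Pred V 0ℓ} → Big P →
           IndependentSequence P ⊎ (∃ λ S → S ⊆ P × Big S × ∀ x → S x → ¬ Big (Non S x))
    core Big {P} BigP with em {P = ∃ λ S → S ⊆ P × Big S × ∀ x → S x → ¬ Big (Non S x)}
    ... | yes found = inj₂ found
    ... | no  none  = inj₁ (point , (λ n → proj₁ (proj₂ (state n)) (point∈ n)) , apart)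
      where
      State : Set _
      State = ∃ λ S → S ⊆ P × Big S

      next : ((S , _) : State) → ∃ λ x → S x × Big (Non S x)
      next (S , S⊆P , BigS) = dne λ stuck → none (S , S⊆P , BigS , λ x Sx big → stuck (x , Sx , big))

      state : ℕ → State
      state zero    = P , id , BigP
      state (suc n) = let S , S⊆P , _ = state n ; x , _ , big = next (state n)
                      in Non S x , (λ y → S⊆P (proj₁ (out y))) , big

      point : ℕ → V
      point n = proj₁ (next (state n))

      point∈ : ∀ n → proj₁ (state n) (point n)
      point∈ n = proj₁ (proj₂ (next (state n)))

      shrink : ∀ {m n} → m ℕ.< n → proj₁ (state n) ⊆ Apart (point m)
      shrink {m} {suc n} m<1+n y with ℕ.m≤n⇒m<n∨m≡n (ℕ.s≤s⁻¹ m<1+n)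
      ... | inj₁ m<n  = shrink m<n (proj₁ (out y))
      ... | inj₂ refl = proj₂ (out y)

      apart : ∀ {m n} → m ℕ.< n → Apart (point m) (point n)
      apart {m} {n} m<n = shrink m<n (point∈ n)

    Near : Pred V 0ℓ → V → Pred V _
    Near S x y = Non S x y ⊎ y ≡ x

    -- By maximality a vertex of `S` outside `K` is non-adjacent to a member of `K`, so the sets
    -- `Near S y` with `y` in `K` cover `S`.
    maximalCliqueIn : (S : Pred V 0ℓ) → Σ[ K ∈ Pred V 0ℓ ]
                      (K ⊆ S × Clique R K × (∀ {x} → S x → ∃ λ (y : Sub K) → Near S (proj₁ y) x))
    maximalCliqueIn S
      with U , clique , maximal ← maximalClique {A = Sub S} (λ x y → R (proj₁ x) (proj₁ y)) R-sym =
      K , (λ k → out (proj₁ (out k))) ,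
      (λ k k′ x≢y → clique (proj₂ (out k)) (proj₂ (out k′)) (x≢y ∘ cong proj₁)) , dominated
      where
      K : Pred V 0ℓ
      K x = ∥ Σ[ s ∈ ∥ S x ∥ ] U (x , s) ∥

      dominated : ∀ {x} → S x → ∃ λ (y : Sub K) → Near S (proj₁ y) x
      dominated {x} Sx = dne λ free →
        let Ux : U (x , ∣ Sx ∣)
            Ux = maximal (x , ∣ Sx ∣) λ (y , Sy) Uy x≢y → dne λ ¬Rxy →
              free ((y , ∣ ∣ Sy , Uy ∣ ∣) , inj₁ ∣ Sx , (λ { refl → x≢y (⟦⟧-≡ refl) }) , ¬Rxy ∘ R-sym ∣)
        in free ((x , ∣ ∣ ∣ Sx ∣ , Ux ∣ ∣) , inj₂ refl)

    -- The Dushnik-Miller theorem for the successor cardinal of `τ`: a maximal clique of size at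
    -- most `τ` would cover `S` by `τ` sets of size at most `τ`.
    bigClique : {τ : Set ℓ} → ℕ ↣ τ → {P : Pred V 0ℓ} → ¬ (Sub P ↣ τ) →
                IndependentSequence P ⊎ (∃ λ K → K ⊆ P × Clique R K × ¬ (Sub K ↣ τ))
    bigClique {τ} ι {P} P⋠τ with core (λ S → ¬ (Sub S ↣ τ)) {P} P⋠τ
    ... | inj₁ seq = inj₁ seq
    ... | inj₂ (S , S⊆P , S⋠τ , thin) with K , K⊆S , clique , dominated ← maximalCliqueIn S =
      inj₂ (K , S⊆P ∘ K⊆S , clique , λ K≼τ → S⋠τ
        (hessenberg τ ι ∘↣ (K≼τ ×↣ ↣-id τ) ∘↣ cover-↣ dominated
          λ (y , Ky) → Maybe-absorb ι ∘↣ Maybe-↣ (dne (thin y (K⊆S (out Ky)))) ∘↣ adjoin))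

    module _ (μ : Set ℓ) (ι : ℕ ↣ μ) where
      open Smallness μ ι

      module Core (S : Pred V 0ℓ) (μ≼S : μ ↣ Sub S) (thin : ∀ x → S x → Small (Sub (Non S x)))
                  (noSequence : ¬ IndependentSequence S)
                  (noClique : ∀ K → K ⊆ S → Clique R K → Small (Sub {p = 0ℓ} K)) where

        small-Near : ∀ {x} → S x → Small (Sub (Near S x))
        small-Near Sx = small-↣ adjoin (small-Maybe (thin _ Sx))

        SmallFibres : Set ℓ → Set ℓ
        SmallFibres I = Σ[ c ∈ (μ → I) ] (∀ i → Small (Sub λ m → c m ≡ i))

        trivialFibres : SmallFibres μ
        trivialFibres = id , λ i → small-Fin (mk↣ {to = λ _ → zero {n = 0}}
          λ {(x , x≡i)} {(y , y≡i)} _ → ⟦⟧-≡ (trans (out x≡i) (sym (out y≡i))))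

        -- I has the size of the cofinality of μ.  If μ is regular, a maximal clique of
        -- S is too large already.  If μ is singular, cliques larger than the fibres
        -- of c are chosen along I, each avoiding the few vertices that are not
        -- adjacent to the previous ones, and their union is too large.
        module Cofinality (I : Set ℓ) (c : μ → I) (fibres : ∀ i → Small (Sub λ m → c m ≡ i))
                          (leastI : ∀ J → SmallFibres J → I ↣ J) where

          -- An embedding of `μ` in `P` would divide `μ` into small fibres over `J`, against the
          -- minimality of `I`.
          small-⋃ : {P : Pred V p} {J : Set ℓ} {D : J → Pred V q} → ¬ (I ↣ J) →
                    (∀ {x} → P x → ∃ λ j → D j x) → (∀ j → Small (Sub (D j))) → Small (Sub P)
          small-⋃ I⋠J cover smallD f = I⋠J (leastI _ (index , λ j → small-↣ (fibre-↣ j) (smallD j)))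
            where open Cover f cover

          -- The regular case: a maximal clique `K` is small, so the cover of `S` by the small sets
          -- `Near S y` has too few members.
          μ-singular : ¬ (μ ↣ I)
          μ-singular μ≼I with K , K⊆S , clique , dominated ← maximalCliqueIn S =
            small-⋃ (λ I≼K → noClique K K⊆S clique (I≼K ∘↣ μ≼I)) dominated
              (λ (_ , Ky) → small-Near (K⊆S (out Ky))) μ≼S

          Fibre : I → Set ℓ
          Fibre i = Sub λ m → c m ≡ i

          ℕ≼I : ℕ ↣ I
          ℕ≼I with ℕ-or-Fin I
          ... | inj₁ ι′      = ι′
          ... | inj₂ (_ , f) = ⊥-elim (small-finite-fibres f fibres (↣-id μ))

          -- Otherwise every fibre embeds in `Y`, and `μ` in the small set `I × Y`.
          cofinal : {Y : Set ℓ} → Small Y → ∃ λ i → Y ↣ Fibre i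
          cofinal smallY = dne λ none → small-× μ-singular smallY
            (fibres-↣ c λ i → ≰⇒≥ λ Y≼ → none (i , Y≼))

          Spread : Pred V 0ℓ → Pred V _
          Spread K x = ∃ λ (y : Sub K) → Near S (proj₁ y) x

          record Block (P : Pred V 0ℓ) (Y : Set ℓ) : Set (lsuc 0ℓ ⊔ ℓ ⊔ r) where
            field
              K       : Pred V 0ℓ
              K⊆P     : K ⊆ P
              clique  : Clique R K
              large   : ¬ (Sub K ↣ Y)
              bounded : Small (Sub (Spread K))

          -- Some Layer i is large, and there the sets Non S x are uniformly bounded, so
          -- that any clique in it has a small Spread.
          block : ∀ {P Y} → P ⊆ S → μ ↣ Sub P → Small Y → Block P Y
          -- If every layer embedded in `Y ⊎ I`, then `μ` would embed in the small set
          -- `I × (Y ⊎ I)`.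
          block {P} {Y} P⊆S μ≼P smallY = fromLayer (dne λ none →
              small-× μ-singular (small-⊎ smallY μ-singular)
                (cover-↣ {D = Layer} cover (λ i → dne λ ⋠ → none (i , ⋠)) ∘↣ μ≼P))
            where
            Layer : I → Pred V 0ℓ
            Layer i x = ∥ P x × (Sub (Non S x) ↣ Fibre i) ∥

            cover : ∀ {x} → P x → ∃ λ i → Layer i x
            cover Px with i , ≼fibre ← cofinal (thin _ (P⊆S Px)) = i , ∣ Px , ≼fibre ∣

            fromLayer : (∃ λ i → ¬ (Sub (Layer i) ↣ (Y ⊎ I))) → Block P Y
            -- In the threshold `Y ⊎ I` the summand `I` provides the infinity that `bigClique`
            -- requires, and `Y` yields `large`.
            fromLayer (i , ⋠) with bigClique (mk↣ {to = inj₂} inj₂-injective ∘↣ ℕ≼I) {Layer i} ⋠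
            ... | inj₁ (s , s∈ , apart) =
              ⊥-elim (noSequence (s , (λ n → P⊆S (proj₁ (out (s∈ n)))) , apart))
            ... | inj₂ (K , K⊆ , clique , K⋠) = record
              { K       = K
              ; K⊆P     = K⊆P
              ; clique  = clique
              ; large   = λ K≼Y → K⋠ (mk↣ {to = inj₁} inj₁-injective ∘↣ K≼Y)
              ; bounded = small-↣
                  (cover-↣ id λ (y , Ky) → Maybe-↣ (proj₂ (out (K⊆ (out Ky)))) ∘↣ adjoin)
                  (small-× (noClique K (P⊆S ∘ K⊆P) clique) (small-Maybe (fibres i)))
              }
              where
              K⊆P : K ⊆ P
              K⊆P k = proj₁ (out (K⊆ k))

          wo = proj₁ (initialOrder I)
          open WellOrder wo
          open Order wo using (Seg)

          Avoids : ∀ {i j} → Block S (Fibre i) → Block S (Fibre j) → Set _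
          Avoids t s = ∀ x → Block.K t x → ¬ Spread (Block.K s) x

          open Transfinite wo (λ i → Block S (Fibre i)) Avoids

          -- Before stage `i` there are fewer than `I` blocks, each with small `Spread`. By
          -- `small-⋃` they block a small set, so `μ` vertices remain.
          avoiding : ∀ i (s : (j : Seg i) → Block S (Fibre (proj₁ j))) →
                     ∃ λ (t : Block S (Fibre i)) → ∀ j → Avoids t (s j)
          avoiding i s = record { Block new hiding (K⊆P) ; K⊆P = λ k → proj₁ (out (Block.K⊆P new k)) } ,
              λ j x k spread → proj₂ (out (Block.K⊆P new k)) (j , spread)
            where
            Blocked : Pred V _
            Blocked x = ∃ λ j → Spread (Block.K (s j)) x

            Remaining : Pred V 0ℓ
            Remaining x = ∥ S x × ¬ Blocked x ∥

            split : ∀ {x} → S x → Blocked x ⊎ Remaining x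
            split {x} Sx with em {P = Blocked x}
            ... | yes blocked = inj₁ blocked
            ... | no  ¬blocked = inj₂ ∣ Sx , ¬blocked ∣

            new : Block Remaining (Fibre i)
            new = block (λ h → proj₁ (out h))
              (dne λ small → small-∪ split
                (small-⋃ (proj₂ (initialOrder I) i) id (λ j → Block.bounded (s j))) small μ≼S)
              (fibres i)

          module Union (family : ∀ i → Block S (Fibre i))
                       (avoids : ∀ {i j} → j < i → Avoids (family i) (family j)) where

            module _ (i : I) where
              open Block (family i) public

            U : Pred V 0ℓ
            U x = ∥ ∃ (λ i → K i x) ∥

            later-adjacent : ∀ {i j x y} → j < i → K i x → K j y → x ≢ y → R x y
            later-adjacent {i} {j} {x} {y} j<i kx ky x≢y = dne λ ¬Rxy →
              avoids j<i x kx ((y , ∣ ky ∣) , inj₁ ∣ K⊆P i kx , x≢y ∘ sym , ¬Rxy ∘ R-sym ∣)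

            U-clique : Clique R U
            U-clique ux uy x≢y with i , kx ← out ux | j , ky ← out uy with total i j
            ... | inj₁ i<j         = R-sym (later-adjacent i<j ky kx (x≢y ∘ sym))
            ... | inj₂ (inj₁ refl) = clique i kx ky x≢y
            ... | inj₂ (inj₂ j<i)  = later-adjacent j<i kx ky x≢y

            -- Fibre `i` embeds in `K i`, hence in `U`; so `μ` embeds in `I × U`, a product of small
            -- sets.
            U-too-large : ⊥
            U-too-large = small-× μ-singular
              (noClique U (λ u → K⊆P (proj₁ (out u)) (proj₂ (out u))) U-clique)
              (fibres-↣ c λ i → Sub-mono (λ k → ∣ i , k ∣) ∘↣ ≰⇒≥ (large i))

          singular : ⊥
          singular = let family , avoids = transfinite avoiding in Union.U-too-large family avoids

        contradiction : ⊥
        contradiction with I , (c , fibres) , leastI ← leastSuch SmallFibres trivialFibres =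
          Cofinality.singular I c fibres leastI

      dushnikMiller : {P : Pred V 0ℓ} → μ ↣ Sub P →
                      IndependentSequence P ⊎ (∃ λ K → K ⊆ P × Clique R K × μ ↣ Sub {p = 0ℓ} K)
      dushnikMiller {P} μ≼P with core (λ S → μ ↣ Sub S) {P} μ≼P
      ... | inj₁ seq = inj₁ seq
      ... | inj₂ (S , S⊆P , μ≼S , thin)
        with em {P = IndependentSequence P} | em {P = ∃ λ K → K ⊆ P × Clique R K × μ ↣ Sub {p = 0ℓ} K}
      ...   | yes seq | _          = inj₁ seq
      ...   | no _    | yes clique = inj₂ clique
      ...   | no noSequence | no noClique = ⊥-elim (Core.contradiction S μ≼S thin
        (λ (s , s∈ , apart) → noSequence (s , S⊆P ∘ s∈ , apart))
        λ K K⊆S clique μ≼K → noClique (K , S⊆P ∘ K⊆S , clique , μ≼K))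

  -- Colouring orders

  module Colouring (μ : Set ℓ) (ι : ℕ ↣ μ) (G : Graph ℓ ℓ) (k : ℕ)
                   (noComplete : ¬ Contains G (complete μ))
                   (noBipartite : ¬ ContainsInduced G (completeBipartite (Fin (suc k)) ℕ)) where
    open Graph G renaming (sym to Adj-sym)
    open Smallness μ ι
    open DushnikMiller Adj Adj-sym

    independentSequence : {P : Pred V p} → μ ↣ Sub P → IndependentSequence P
    independentSequence {P = P} μ≼P
      with dushnikMiller μ ι {λ v → ∥ P v ∥} (Sub-mono ∣_∣ ∘↣ μ≼P)
    ... | inj₁ (s , s∈ , apart) = s , out ∘ s∈ , apart
    ... | inj₂ (K , _ , clique , μ≼K) = ⊥-elim (noComplete record
      { embed     = proj₁ ∘ to μ≼K
      ; injective = injective (inclusion ∘↣ μ≼K)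
      ; preserves = λ {x} {y} x≢y → clique (out (proj₂ (to μ≼K x))) (out (proj₂ (to μ≼K y)))
                      (x≢y ∘ injective (inclusion ∘↣ μ≼K))
      })

    -- Tuples are vectors because the coding of derivations must recover `f` from its entries, which
    -- for functions would take extensionality.
    Independent : Pred (Vec V (suc k)) ℓ
    Independent f = ∀ i j → i ≢ j → Apart (lookup f i) (lookup f j)

    Common : Vec V (suc k) → Pred V ℓ
    Common f v = ∀ i → Adj (lookup f i) v

    small-Common : ∀ f → Independent f → Small (Sub (Common f))
    small-Common f independent μ≼ with s , s∈ , apart ← independentSequence μ≼ = noBipartite record
      { contains = record { embed = embed ; injective = embed-injective ; preserves = preserves }
      ; reflects = reflects
      }
      where
      embed : Fin (suc k) ⊎ ℕ → V
      embed (inj₁ i) = lookup f i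
      embed (inj₂ n) = s n

      s-apart : ∀ {m n} → m ≢ n → Apart (s m) (s n)
      s-apart {m} {n} m≢n with ℕ.<-cmp m n
      ... | tri< m<n _ _ = apart m<n
      ... | tri≈ _ m≡n _ = ⊥-elim (m≢n m≡n)
      ... | tri> _ _ n<m = let ≢ , ¬adj = apart n<m in ≢ ∘ sym , ¬adj ∘ Adj-sym

      embed-injective : Injective _≡_ _≡_ embed
      embed-injective {inj₁ i} {inj₁ j} eq = cong inj₁ (dne λ i≢j → proj₁ (independent i j i≢j) eq)
      embed-injective {inj₁ i} {inj₂ n} eq = ⊥-elim (irrefl eq (s∈ n i))
      embed-injective {inj₂ m} {inj₁ j} eq = ⊥-elim (irrefl (sym eq) (s∈ m j))
      embed-injective {inj₂ m} {inj₂ n} eq = cong inj₂ (dne λ m≢n → proj₁ (s-apart m≢n) eq)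

      preserves : ∀ {x y} → Across x y → Adj (embed x) (embed y)
      preserves (left-right i n) = s∈ n i
      preserves (right-left i n) = Adj-sym (s∈ n i)

      reflects : ∀ {x y} → Adj (embed x) (embed y) → Across x y
      reflects {inj₁ i} {inj₂ n} _ = left-right i n
      reflects {inj₂ m} {inj₁ j} _ = right-left j m
      reflects {inj₁ i} {inj₁ j} adj =
        ⊥-elim (proj₂ (independent i j λ { refl → irrefl refl adj }) adj)
      reflects {inj₂ m} {inj₂ n} adj =
        ⊥-elim (proj₂ (s-apart {m} {n} λ { refl → irrefl refl adj }) adj)

    data Closure (P : Pred V p) : V → Set (ℓ ⊔ p) where
      base : ∀ {v} → P v → Closure P v
      step : ∀ {v} f → Independent f → (∀ i → Closure P (lookup f i)) → Common f v → Closure P v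

    Closure-mono : {P : Pred V p} {Q : Pred V q} → P ⊆ Q → Closure P ⊆ Closure Q
    Closure-mono P⊆Q (base Pv)           = base (P⊆Q Pv)
    Closure-mono P⊆Q (step f ind ds com) = step f ind (λ i → Closure-mono P⊆Q (ds i)) com

    -- Among `μ` neighbours in the closure there is an independent sequence; its first `suc k` terms
    -- have `v` as a common neighbour and would put it into the closure.
    small-trace : {P : Pred V p} {v : V} → ¬ Closure P v → Small (Sub λ w → Adj v w × Closure P w)
    small-trace {P = P} {v} v∉ μ≼ with s , s∈ , apart ← independentSequence μ≼ =
      v∉ (step f independent
        (λ i → subst (Closure P) (sym (f-s i)) (proj₂ (s∈ (toℕ i))))
        (λ i → subst (λ w → Adj w v) (sym (f-s i)) (Adj-sym (proj₁ (s∈ (toℕ i))))))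
      where
      f : Vec V (suc k)
      f = tabulate (s ∘ toℕ)

      f-s : ∀ i → lookup f i ≡ s (toℕ i)
      f-s = lookup∘tabulate (s ∘ toℕ)

      independent : Independent f
      independent i j i≢j rewrite f-s i | f-s j with ℕ.<-cmp (toℕ i) (toℕ j)
      ... | tri< i<j _ _ = apart i<j
      ... | tri≈ _ i≡j _ = ⊥-elim (i≢j (toℕ-injective i≡j))
      ... | tri> _ _ j<i = let ≢ , ¬adj = apart j<i in ≢ ∘ sym , ¬adj ∘ Adj-sym

    -- A derivation of membership in the closure is coded as a finite tree over μ.
    module Coding {P : Pred V p} (code₀ : Sub P ↣ μ) where

      pair : (μ × μ) ↣ μ
      pair = hessenberg μ ι

      split : ∀ {a b c d} → to pair (a , b) ≡ to pair (c , d) → a ≡ c × b ≡ d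
      split eq = let e = injective pair eq in cong proj₁ e , cong proj₂ e

      tuple : ∀ n → (Fin n → μ) → μ
      tuple zero    h = to ι zero
      tuple (suc n) h = to pair (h zero , tuple n (h ∘ suc))

      tuple-injective : ∀ n h h′ → tuple n h ≡ tuple n h′ → ∀ i → h i ≡ h′ i
      tuple-injective (suc n) h h′ eq zero    = proj₁ (split eq)
      tuple-injective (suc n) h h′ eq (suc i) = tuple-injective n (h ∘ suc) (h′ ∘ suc) (proj₂ (split eq)) i

      -- Including independence makes `child` total: the set is empty for other vectors.
      Child : Vec V (suc k) → Pred V ℓ
      Child f v = Independent f × Common f v

      child : ∀ f → Sub (Child f) ↣ μ
      child f = ≰⇒≥ λ μ≼ →
        small-Common f (proj₁ (out {P = Child f _} (proj₂ (to μ≼ (to ι zero)))))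
          (Sub-mono {P = Child f} proj₂ ∘↣ μ≼)

      code : ∀ {v} → Closure P v → μ
      -- The tags `to ι 0` and `to ι 1` separate generators from derived vertices.
      code (base Pv)           = to pair (to ι 0 , to code₀ (_ , ∣ Pv ∣))
      code (step f ind ds com) =
        to pair (to ι 1 , to pair (tuple (suc k) (λ i → code (ds i)) , to (child f) (_ , ∣ ind , com ∣)))

      code-injective : ∀ {v w} (d : Closure P v) (e : Closure P w) → code d ≡ code e → v ≡ w
      code-injective (base Pv) (base Pw) eq = cong proj₁ (injective code₀ (proj₂ (split eq)))
      code-injective (base Pv) (step _ _ _ _) eq with () ← injective ι (proj₁ (split eq))
      code-injective (step _ _ _ _) (base Pw) eq with () ← injective ι (proj₁ (split eq))
      code-injective {v} {w} (step f ind ds com) (step f′ ind′ ds′ com′) eq =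
        same f≡f′ (proj₂ (split (proj₂ (split eq))))
        where
        f≡f′ : f ≡ f′
        f≡f′ = trans (sym (tabulate∘lookup f)) (trans (tabulate-cong λ i →
          code-injective (ds i) (ds′ i) (tuple-injective (suc k) (code ∘ ds) (code ∘ ds′) (proj₁ (split (proj₂ (split eq)))) i))
          (tabulate∘lookup f′))
        same : ∀ {f f′ h h′} → f ≡ f′ → to (child f) (v , h) ≡ to (child f′) (w , h′) → v ≡ w
        same {f} refl eq = cong proj₁ (injective (child f) eq)

      closure-↣ : Sub (Closure P) ↣ μ
      closure-↣ = mk↣ {to = λ (v , h) → code (out h)}
        λ {(v , h)} {(w , h′)} eq → ⟦⟧-≡ (code-injective (out h) (out h′) eq)

    -- Ordering closures by induction on the number of generators

    Good : Pred V p → Set _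
    Good P = Σ[ wo ∈ WellOrder (Sub P) ]
      (∀ x → Small (Sub λ y → Adj (proj₁ x) (proj₁ y) × WellOrder._<_ wo y x))

    Good-⊆ : {P : Pred V p} {Q : Pred V q} → P ⊆ Q → Good Q → Good P
    Good-⊆ P⊆Q (wo , small) = pullback (Sub-mono P⊆Q) wo ,
      λ x → small-↣ (Sub-map (Sub-mono P⊆Q) id) (small (to (Sub-mono P⊆Q) x))

    Image : {X : Set ℓ} → (X → V) → Pred V ℓ
    Image g v = ∃ λ x → g x ≡ v

    few-generators : {X : Set ℓ} (g : X → V) → X ↣ μ → Good (Closure (Image g))
    few-generators g X≼μ = pullback closure-↣ (proj₁ (initialOrder μ)) ,
      λ x → small-↣ (Sub-map closure-↣ proj₂) (proj₂ (initialOrder μ) (to closure-↣ x))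
      where open Coding (X≼μ ∘↣ image-↣ {f = g})

    module ManyGenerators {X : Set ℓ} (g : X → V) (X⋠μ : ¬ (X ↣ μ))
      (ih : (Y : Set ℓ) → ¬ (X ↣ Y) → (h : Y → V) → Good (Closure (Image h))) where

      ℕ≼X : ℕ ↣ X
      ℕ≼X = ≰⇒≥ X⋠μ ∘↣ ι

      wo = proj₁ (initialOrder X)
      open WellOrder wo
      open Order wo

      From : Pred X q → Pred V (q ⊔ ℓ)
      From Q v = ∃ λ x → Q x × g x ≡ v

      bound : {Q : Pred X q} → ∀ n (h : Fin (suc n) → X) → (∀ i → Q (h i)) → ∃ λ x → Q x × ∀ i → h i ≤ x
      bound zero    h Qh = h zero , Qh zero , λ { zero → inj₂ refl }
      bound (suc n) h Qh with bound n (h ∘ suc) (Qh ∘ suc)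
      ... | x , Qx , ≤x with total x (h zero)
      ...   | inj₁ x<h         = h zero , Qh zero , λ { zero → inj₂ refl ; (suc i) → ≤-trans (≤x i) (inj₁ x<h) }
      ...   | inj₂ (inj₁ refl) = x , Qx , λ { zero → inj₂ refl ; (suc i) → ≤x i }
      ...   | inj₂ (inj₂ h<x)  = x , Qx , λ { zero → inj₁ h<x ; (suc i) → ≤x i }

      -- A derivation uses finitely many generators, and the largest of them bounds all the others.
      localize : {Q : Pred X q} → ∀ {v} → Closure (From Q) v → ∃ λ x → Q x × Closure (From (_≤ x)) v
      localize (base (x , Qx , gx≡v)) = x , Qx , base (x , inj₂ refl , gx≡v)
      localize (step f ind ds com) 
        with bound k (λ i → proj₁ (localize (ds i))) (λ i → proj₁ (proj₂ (localize (ds i))))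
      ... | x , Qx , ≤x = x , Qx , step f ind
        (λ i → Closure-mono (λ (y , y≤ , eq) → y , ≤-trans y≤ (≤x i) , eq) (proj₂ (proj₂ (localize (ds i)))))
        com

      Vertex : Set ℓ
      Vertex = Sub (Closure (Image g))

      stage : (v : Vertex) → ∃ λ x → Closure (From (_≤ x)) (proj₁ v) ×
                                     (∀ y → y < x → ¬ Closure (From (_≤ y)) (proj₁ v))
      stage (v , h) = least (λ x → Closure (From (_≤ x)) v)
        (let x , _ , d = localize {Q = λ _ → ⊤} (Closure-mono (λ (x , eq) → x , tt , eq) (out h))
         in x , d)

      rank : Vertex → X
      rank v = proj₁ (stage v)

      -- By `localize`, the closure of the generators before `rank v` is a union of earlier stages,
      -- and minimality keeps `v` out of these.
      rank-fresh : ∀ v → ¬ Closure (From (_< rank v)) (proj₁ v)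
      rank-fresh v d = let y , y<rank , e = localize d in proj₂ (proj₂ (stage v)) y y<rank e

      -- Closed segments of an initial order are smaller than `X`, so the induction hypothesis
      -- applies to them.
      good : ∀ x → Good (Closure (From (_≤ x)))
      good x = Good-⊆ (Closure-mono λ (y , y≤x , eq) → (y , ∣ y≤x ∣) , eq)
        (ih (Sub (_≤ x)) few (g ∘ proj₁))
        where
        few : ¬ (X ↣ Sub (_≤ x))
        few = Smallness.small-↣ X ℕ≼X (closed-segment x)
          (Smallness.small-Maybe X ℕ≼X (proj₂ (initialOrder X) x))

      enter : ∀ v {x} → rank v ≡ x → Closure (From (_≤ x)) (proj₁ v)
      enter v refl = proj₁ (proj₂ (stage v))

      layer-↣ : ∀ x → Sub (λ v → rank v ≡ x) ↣ Sub (Closure (From (_≤ x)))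
      layer-↣ x = mk↣ {to = λ (v , e) → proj₁ v , ∣ enter v (out e) ∣} λ eq → ⟦⟧-≡ (⟦⟧-≡ (cong proj₁ eq))

      layer : ∀ x → WellOrder (Sub λ v → rank v ≡ x)
      layer x = pullback (layer-↣ x) (proj₁ (good x))

      open Lexicographic wo rank layer

      -- Neighbours of smaller rank lie in a closure omitting `v`, where `small-trace` bounds them;
      -- those of equal rank are bounded by the order of the layer.
      few-back-neighbours : ∀ v → Small (Sub λ w → Adj (proj₁ v) (proj₁ w) × ∥ Lex w v ∥)
      few-back-neighbours v = small-∪ cover
        (small-↣ (Sub-map inclusion λ {w} (adj , ranks) → adj , earlier w ranks) (small-trace (rank-fresh v)))
        (small-↣ same-layer (proj₂ (good (rank v)) (to (layer-↣ (rank v)) (v , ∣ refl ∣))))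
        where
        SameLayer : Pred Vertex _
        SameLayer w = Adj (proj₁ v) (proj₁ w) ×
          Σ[ e ∈ rank w ≡ rank v ] Layer._<_ (rank v) (w , ∣ e ∣) (v , ∣ refl ∣)

        cover : ∀ {w} → Adj (proj₁ v) (proj₁ w) × ∥ Lex w v ∥ →
                (Adj (proj₁ v) (proj₁ w) × rank w < rank v) ⊎ SameLayer w
        cover (adj , l) with out l
        ... | inj₁ ranks = inj₁ (adj , ranks)
        ... | inj₂ same  = inj₂ (adj , same)

        earlier : ∀ w → rank w < rank v → Closure (From (_< rank v)) (proj₁ w)
        earlier w ranks = Closure-mono (λ (y , y≤ , eq) → y , ≤-<-trans y≤ ranks , eq) (enter w refl)

        same-layer : Sub SameLayer ↣ Sub _
        same-layer = mk↣
          {to = λ (w , s) → let adj , e , l = out s in to (layer-↣ (rank v)) (w , ∣ e ∣) , ∣ adj , l ∣}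
          λ eq → ⟦⟧-≡ (⟦⟧-≡ (cong (proj₁ ∘ proj₁) eq))

      many-generators : Good (Closure (Image g))
      many-generators = lexicographic , few-back-neighbours

    closure-good : (X : Set ℓ) (g : X → V) → Good (Closure (Image g))
    closure-good = cardinalInduction (λ X → (g : X → V) → Good (Closure (Image g))) split
      where
      split : (X : Set ℓ) → ((Y : Set ℓ) → ¬ (X ↣ Y) → (h : Y → V) → Good (Closure (Image h))) →
              (g : X → V) → Good (Closure (Image g))
      split X ih g with em {P = X ↣ μ}
      ... | yes X≼μ = few-generators g X≼μ
      ... | no  X⋠μ = ManyGenerators.many-generators g X⋠μ ih

    -- Passage to colouring orders

    module _ (wo : WellOrder V) (small : ∀ x → Small (Sub λ y → Adj x y × WellOrder._<_ wo y x)) where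
      open WellOrder wo hiding (irrefl)

      _<*_ : Rel V ℓ
      x <* y = Lift ℓ (x < y)

      isWellOrder : IsWellOrder _<*_
      isWellOrder = record
        { isStrictPartialOrder = record
          { isEquivalence = isEquivalence
          ; irrefl        = λ { refl (lift x<x) → asym x<x x<x }
          ; trans         = λ (lift x<y) (lift y<z) → lift (<-trans x<y y<z)
          ; <-resp-≈      = (λ { refl → id }) , (λ { refl → id })
          }
        ; compare = compare
        } , λ x → lift-acc (wf x)
        where
        compare : ∀ x y → Tri (x <* y) (x ≡ y) (y <* x)
        compare x y with total x y
        ... | inj₁ x<y         = tri< (lift x<y) (λ { refl → asym x<y x<y }) (asym x<y ∘ lower)
        ... | inj₂ (inj₁ refl) = tri≈ (λ (lift x<x) → asym x<x x<x) refl (λ (lift x<x) → asym x<x x<x)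
        ... | inj₂ (inj₂ y<x)  = tri> (asym y<x ∘ lower) (λ { refl → asym y<x y<x }) (lift y<x)
        lift-acc : ∀ {x} → Acc _<_ x → Acc _<*_ x
        lift-acc (acc rs) = acc λ (lift y<x) → lift-acc (rs y<x)

      members-≺ : ∀ x → members (N x ∩ (λ w → w <* x)) ≺ setoid μ
      members-≺ x = record
          { to        = λ (w , h) → to few (w , ∣ h ∣)
          ; cong      = λ eq → cong (to few) (⟦⟧-≡ eq)
          ; injective = λ eq → cong proj₁ (injective few eq)
          } , λ f → small′ (mk↣ {to = λ m → proj₁ (to f m) , ∣ proj₂ (to f m) ∣}
                (injective f ∘ cong proj₁))
        where
        small′ : Small (Sub (N x ∩ (λ w → w <* x)))
        small′ = small-↣ (Sub-mono λ (adj , lift w<x) → adj , w<x) (small x)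
        few : Sub (N x ∩ (λ w → w <* x)) ↣ μ
        few = ≰⇒≥ small′

      fromWellOrder : HasColouringOrder G μ
      fromWellOrder = _<*_ , isWellOrder , members-≺

    hasColouringOrder : HasColouringOrder G μ
    hasColouringOrder =
      -- With every vertex as a generator the closure is the whole of `V`.
      let wo , small = closure-good V id
      in fromWellOrder (pullback everything wo) λ x → small-↣ (Sub-map everything id) (small (to everything x))
      where
      everything : V ↣ Sub (Closure (Image id))
      everything = mk↣ {to = λ v → v , ∣ base (v , refl) ∣} (cong proj₁)

theorem1p4 : (∀ {a} → ExcludedMiddle a) → (∀ {a} → AxiomOfChoice a) →
    ∀ {ℓ} (μ : Set ℓ) → Infinite μ →
    (G : Graph ℓ ℓ) (κ : Set ℓ) → IsColouringNumber G κ → setoid μ ≺ setoid κ →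
    Contains G (complete μ) ⊎
    (∀ k → .{{NonZero k}} → ContainsInduced G (completeBipartite (Fin k) ℕ))
theorem1p4 em ac μ infinite G κ (_ , leastκ) (_ , κ⋠μ) with em {P = Contains G (complete μ)}
... | yes contains   = inj₁ contains
... | no  noComplete = inj₂ λ where
    zero    → ⊥-elim (ℕ.≢-nonZero⁻¹ 0 refl)
    -- Without the bipartite graph `μ` itself admits a colouring order, so minimality embeds `κ` in
    -- `μ`.
    (suc k) → dne λ noBipartite → κ⋠μ (leastκ μ
      (Colouring.hasColouringOrder μ (infinite⇒ℕ↣ infinite) G k noComplete noBipartite))
  where open Classical em ac
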